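{- Let $t\ge 2$. For every class $\mathcal{H}$ of graphs excluding $K_t$ as a minor, the class of region intersection graphs over $\mathcal{H}$ has asymptotic dimension at most $2^{t-2}-1$.
   Context: Graphs are finite, simple and undirected; $\mathbb{N}=\{1,2,\ldots\}$, $[k]=\{1,\ldots,k\}$. A region intersection model of a graph $G$ over a graph $H$ is a mapping $\mu$ from $V(G)$ to connected vertex sets in $H$ such that, for distinct $u,v\in V(G)$, $\mu(u)\cap\mu(v)\ne\emptyset$ exactly when $uv$ is an edge of $G$. $G$ is a region intersection graph over $\mathcal{H}$ if it has a region intersection model over some $H\in\mathcal{H}$. $d_G(x,y)$ is the shortest-path distance in $G$ ($\infty$ between different components). The diameter of $S\subseteq V(G)$ in $G$ is $\max_{x,y\in S}d_G(x,y)$. A family $\mathcal{U}$ of subsets of $V(G)$ is $\delta$-disjoint if all distinct $X,Y\in\mathcal{U}$ satisfy $\min_{x\in X}\min_{y\in Y}d_G(x,y)>\delta$, and $(k,\delta)$-disjoint if $\mathcal{U}=\bigcup_{i=1}^k\mathcal{U}_i$ where each $\mathcal{U}_i$, $i\in[k]$, is $\delta$-disjoint. A function $f\colon\{0,1,2,\ldots\}\to\mathbb{N}$ is a $d$-dimensional control function for $G$ if for every integer $\delta\ge0$ there is a $(d+1,\delta)$-disjoint partition of $V(G)$ into sets of diameter at most $f(\delta)$ in $G$. The asymptotic dimension of a graph class $\mathcal{G}$ is the minimum $d$ such that there is a $d$-dimensional control function common for all graphs in $\mathcal{G}$ (infinite if no such $d$ exists). -}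

module Defs where

open import Data.Fin using (Fin; zero; suc; toℕ)
open import Data.Fin.Properties using (any?; pigeonhole; toℕ<n) renaming (_≟_ to _≟ᶠ_)
open import Data.Fin.Subset using (Subset; _∈_; _∩_; Nonempty; Empty)
open import Data.Nat using (ℕ; zero; suc; _+_; _∸_; _≤_; _<_; _≤?_; s≤s)
open import Data.Nat.Induction using (<-rec)
open import Data.Nat.Properties
  using (anyUpTo?; ≮⇒≥; ≰⇒>; <⇒≱; ≤-pred; m+[n∸m]≡n; +-monoˡ-<; module ≤-Reasoning)
open import Data.Product using (Σ; ∃; ∃-syntax; _×_; _,_; proj₁; proj₂)
open import Function.Bundles using (_⇔_)
open import Level using (Level; 0ℓ) renaming (suc to lsuc; _⊔_ to _⊔ˡ_)
open import Relation.Binary.Construct.Closure.ReflexiveTransitive using (Star)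
open import Relation.Binary.Core using (Rel)
open import Relation.Binary.Definitions using (Decidable; Symmetric)
open import Relation.Binary.PropositionalEquality
  using (_≡_; _≢_; refl; sym; subst)
open import Relation.Nullary using (¬_; Dec; yes; no)
open import Relation.Nullary.Construct.Add.Supremum using (_⁺; [_]; ⊤⁺)
open import Relation.Nullary.Decidable using (map′; _×-dec_; ¬?)
open import Relation.Unary using (Pred; _≐_; ⋃)

open import Relation.Binary.Construct.Add.Supremum.NonStrict _≤_ public using (_≤⁺_)
open import Relation.Binary.Construct.Add.Supremum.Strict _<_ public using (_<⁺_)

private
  variable
    ℓ : Level

-- Adjacency is decidable because a finite graph has a finite (decidable) edge set.
record Graph : Set₁ where
  field
    order   : ℕ
    Adj     : Rel (Fin order) 0ℓ
    adj?    : Decidable Adj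
    adj-sym : Symmetric Adj
    no-loop : ∀ v → ¬ Adj v v

  V : Set
  V = Fin order

  VSet : Set
  VSet = Subset order

open Graph public using (V; VSet)

GraphClass : (ℓ : Level) → Set (lsuc 0ℓ ⊔ˡ lsuc ℓ)
GraphClass ℓ = Pred Graph ℓ

K : ℕ → Graph
K t = record
  { order   = t
  ; Adj     = _≢_
  ; adj?    = λ u v → ¬? (u ≟ᶠ v)
  ; adj-sym = λ u≢v v≡u → u≢v (sym v≡u)
  ; no-loop = λ _ v≢v → v≢v refl
  }

module _ (G : Graph) where
  open Graph G using (order; Adj; adj?)

  -- The last index is the number of edges.
  data Walk : V G → V G → ℕ → Set where
    done : ∀ {x} → Walk x x 0
    step : ∀ {x y z k} → Adj x y → Walk y z k → Walk x z (suc k)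

  -- A shortest walk is a shortest path, so minimising over walks is enough.
  data IsDistance (x y : V G) : ℕ ⁺ → Set where
    finite   : ∀ {k} → Walk x y k → (∀ {m} → Walk x y m → k ≤ m) → IsDistance x y [ k ]
    infinite : (∀ {m} → ¬ Walk x y m) → IsDistance x y ⊤⁺

  private
    walk? : ∀ k x y → Dec (Walk x y k)
    walk? zero x y = map′ (λ { refl → done }) (λ { done → refl }) (x ≟ᶠ y)
    walk? (suc k) x z =
      map′ (λ { (_ , e , w) → step e w }) (λ { (step e w) → _ , e , w })
           (any? (λ y → adj? x y ×-dec walk? k y z))

    vertexAt : ∀ {x y k} → Walk x y k → Fin (suc k) → V G
    vertexAt {x} w          zero    = x
    vertexAt     (step _ w) (suc i) = vertexAt w i

    take : ∀ {x y k} (w : Walk x y k) i → Walk x (vertexAt w i) (toℕ i)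
    take w          zero    = done
    take (step e w) (suc i) = step e (take w i)

    drop : ∀ {x y k} (w : Walk x y k) i → Walk (vertexAt w i) y (k ∸ toℕ i)
    drop w          zero    = w
    drop (step _ w) (suc i) = drop w i

    _++_ : ∀ {x y z k l} → Walk x y k → Walk y z l → Walk x z (k + l)
    done     ++ w = w
    step e v ++ w = step e (v ++ w)

    shorten : ∀ {x y k} → Walk x y k → order ≤ k → ∃[ m ] m < k × Walk x y m
    shorten {y = y} {k} w n≤k
      with i , j , i<j , eq ← pigeonhole (s≤s n≤k) (vertexAt w)
      = toℕ i + (k ∸ toℕ j) , shorter
      , (take w i ++ subst (λ v → Walk v y (k ∸ toℕ j)) (sym eq) (drop w j))
      where
      open ≤-Reasoning
      shorter : toℕ i + (k ∸ toℕ j) < k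
      shorter = begin-strict
        toℕ i + (k ∸ toℕ j) <⟨ +-monoˡ-< (k ∸ toℕ j) i<j ⟩
        toℕ j + (k ∸ toℕ j) ≡⟨ m+[n∸m]≡n (≤-pred (toℕ<n j)) ⟩
        k                   ∎

    shortest : ∀ {x y} k → Walk x y k →
               ∃[ m ] Walk x y m × (∀ {l} → Walk x y l → m ≤ l)
    shortest {x} {y} = <-rec _ λ k rec w → search k rec w
      where
      Shortest : Set
      Shortest = ∃[ m ] Walk x y m × (∀ {l} → Walk x y l → m ≤ l)
      search : ∀ k → (∀ {j} → j < k → Walk x y j → Shortest) → Walk x y k → Shortest
      search k rec w with anyUpTo? (λ m → walk? m x y) k
      ... | yes (j , j<k , v) = rec j<k v
      ... | no none = k , w , λ v → ≮⇒≥ (λ l<k → none (_ , l<k , v))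

  distance : ∀ x y → ∃ (IsDistance x y)
  distance x y with anyUpTo? (λ m → walk? m x y) order
  ... | yes (k , _ , w) with m , v , minimal ← shortest k w = [ m ] , finite v minimal
  ... | no none = ⊤⁺ , infinite λ {k} w → absurd (shortest k w)
    where
    absurd : ¬ (∃[ m ] Walk x y m × (∀ {l} → Walk x y l → m ≤ l))
    absurd (m , v , minimal) with order ≤? m
    ... | no n≰m = none (m , ≰⇒> n≰m , v)
    ... | yes n≤m with l , l<m , u ← shorten v n≤m = <⇒≱ l<m (minimal u)

  dist : V G → V G → ℕ ⁺
  dist x y = proj₁ (distance x y)

  dist-isDistance : ∀ x y → IsDistance x y (dist x y)
  dist-isDistance x y = proj₂ (distance x y)

  -- Connected sets are nonempty, as usual for branch sets and regions.
  Connected : VSet G → Set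
  Connected S = Nonempty S ×
    (∀ {x y} → x ∈ S → y ∈ S → Star (λ u v → u ∈ S × v ∈ S × Adj u v) x y)

  DiameterAtMost : ℕ → VSet G → Set
  DiameterAtMost r S = ∀ {x y} → x ∈ S → y ∈ S → dist x y ≤⁺ [ r ]

  Family : Set₁
  Family = Pred (VSet G) 0ℓ

  Disjoint : ℕ → Family → Set
  Disjoint δ 𝓤 = ∀ {X Y} → 𝓤 X → 𝓤 Y → X ≢ Y →
    ∀ {x y} → x ∈ X → y ∈ Y → [ δ ] <⁺ dist x y

  MultiDisjoint : ℕ → ℕ → Family → Set₁
  MultiDisjoint k δ 𝓤 = Σ (Fin k → Family) λ 𝓤s →
    (𝓤 ≐ ⋃ (Fin k) 𝓤s) × (∀ i → Disjoint δ (𝓤s i))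

  record IsPartition (𝓤 : Family) : Set where
    field
      nonempty : ∀ {X} → 𝓤 X → Nonempty X
      disjoint : ∀ {X Y} → 𝓤 X → 𝓤 Y → X ≢ Y → Empty (X ∩ Y)
      covers   : ∀ v → ∃[ X ] 𝓤 X × v ∈ X

  record IsControlFunction (d : ℕ) (f : ℕ → ℕ) : Set₁ where
    field
      positive  : ∀ δ → 1 ≤ f δ
      partition : ∀ δ → Σ Family λ 𝓤 →
        IsPartition 𝓤 × MultiDisjoint (suc d) δ 𝓤 × (∀ {X} → 𝓤 X → DiameterAtMost (f δ) X)

-- The asymptotic dimension is the least d admitting a common control function,
-- so it is at most D exactly when some d ≤ D admits one.
AsdimAtMost : GraphClass ℓ → ℕ → Set (lsuc 0ℓ ⊔ˡ ℓ)
AsdimAtMost 𝓖 D = ∃[ d ] d ≤ D × Σ (ℕ → ℕ) λ f → ∀ G → 𝓖 G → IsControlFunction G d f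

record MinorModel (M H : Graph) : Set where
  field
    branch    : V M → VSet H
    connected : ∀ u → Connected H (branch u)
    disjoint  : ∀ {u v} → u ≢ v → Empty (branch u ∩ branch v)
    joined    : ∀ {u v} → Graph.Adj M u v →
                ∃[ a ] ∃[ b ] a ∈ branch u × b ∈ branch v × Graph.Adj H a b

ExcludesMinor : Graph → GraphClass ℓ → Set (lsuc 0ℓ ⊔ˡ ℓ)
ExcludesMinor M 𝓗 = ∀ H → 𝓗 H → ¬ MinorModel M H

record RegionIntersectionModel (G H : Graph) : Set where
  field
    μ          : V G → VSet H
    connected  : ∀ u → Connected H (μ u)
    intersects : ∀ {u v} → u ≢ v → Nonempty (μ u ∩ μ v) ⇔ Graph.Adj G u v

RegionIntersectionGraphs : GraphClass ℓ → GraphClass (lsuc 0ℓ ⊔ˡ ℓ)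
RegionIntersectionGraphs 𝓗 G = ∃[ H ] 𝓗 H × RegionIntersectionModel G H

{-# OPTIONS --safe #-}
module Submission where

-- Fix δ and thicken the region of u to the union of the regions of the vertices at distance at most δ
-- from u; thickened regions are connected in H, so it suffices to color V(H) with 2 ^ (t ∸ 2) colors
-- such that monochromatic chains of vertices, consecutive ones sharing a region, have bounded
-- diameter in the metric Γ counting regions. As in Klein, Plotkin and Rao, color by the parity of the
-- breadth-first level and repeat inside each level (thickened by one on both sides). All vertices of
-- a monochromatic chain then see the same t ∸ 1 breadth-first roots. If some x were far in Γ from all
-- its roots, a K t minor could be built outwards from the innermost level: from the tips of the
-- branch sets found inside a level, climb towards the root of that layering along paths which are
-- short in Γ and hence disjoint, and add the ball around the root as a new branch set. Its tip is
-- taken on a geodesic from x to the root, at a prescribed Γ-distance from x. So a monochromatic chain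
-- is covered by t ∸ 1 balls of bounded radius, and its diameter is bounded.

open import Defs
open import Data.Empty using (⊥-elim)
open import Data.Fin using (Fin; zero; suc; toℕ; combine)
open import Data.Fin.Properties using (any?; toℕ-injective; combine-injectiveˡ; combine-injectiveʳ)
  renaming (_≟_ to _≟ᶠ_)
open import Data.Fin.Subset using (Subset; _∈_; _⊆_; _∩_; _∪_; ⊤; ⁅_⁆; Nonempty)
open import Data.Fin.Subset.Properties
  using (_∈?_; ∈⊤; x∈⁅x⁆; x∈⁅y⁆⇒x≡y; x∈p∩q⁺; x∈p∩q⁻; p⊆p∪q; q⊆p∪q; x∈p∪q⁻; ⊆-antisym)
open import Data.Nat using (ℕ; zero; suc; _+_; _*_; _∸_; _^_; _≤_; _<_; z≤n; s≤s; _≤?_; _≟_)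
open import Data.Nat.Properties
open import Data.Product using (Σ; ∃; ∃-syntax; _×_; _,_; proj₁; proj₂)
open import Data.Sum using (_⊎_; inj₁; inj₂)
open import Data.Vec using (Vec; []; _∷_; tabulate)
open import Data.Vec.Properties using (lookup∘tabulate; []=⇒lookup; lookup⇒[]=)
open import Data.Vec.Relation.Unary.Any as Any using (Any; here; there)
open import Function using (_∘_)
open import Function.Bundles using (Equivalence)
open import Level using (0ℓ)
open import Relation.Binary.Construct.Closure.ReflexiveTransitive as Star
  using (Star; ε; _◅_; _◅◅_)
open import Relation.Binary.PropositionalEquality
  using (_≡_; _≢_; refl; sym; trans; cong; cong₂; subst)
open import Relation.Nullary using (¬_; Dec; yes; no; does; contradiction)
open import Relation.Nullary.Construct.Add.Supremum using ([_])
open import Relation.Binary.Construct.Add.Supremum.NonStrict _≤_ using ([_])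
open import Relation.Binary.Construct.Add.Supremum.Strict _<_ using ([_]; [_]<⊤⁺)
open import Relation.Nullary.Decidable using (map′; _×-dec_; ¬?; dec-true)
open import Relation.Unary using (Pred; Decidable)

open Graph using (order; Adj; adj?; adj-sym; no-loop)

private
  variable
    n k l : ℕ

-- Decidable subsets, least elements and parities.

⟦_⟧ : {P : Pred (Fin n) 0ℓ} → Decidable P → Subset n
⟦ P? ⟧ = tabulate (does ∘ P?)

∈⟦⟧⁺ : {P : Pred (Fin n) 0ℓ} (P? : Decidable P) {x : Fin n} → P x → x ∈ ⟦ P? ⟧
∈⟦⟧⁺ P? {x} px =
  lookup⇒[]= x ⟦ P? ⟧ (trans (lookup∘tabulate (does ∘ P?) x) (dec-true (P? x) px))

∈⟦⟧⁻ : {P : Pred (Fin n) 0ℓ} (P? : Decidable P) {x : Fin n} → x ∈ ⟦ P? ⟧ → P x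
∈⟦⟧⁻ P? {x} x∈ with P? x | trans (sym (lookup∘tabulate (does ∘ P?) x)) ([]=⇒lookup x∈)
... | yes px | _ = px
... | no _   | ()

least : {P : Pred (Fin n) 0ℓ} → Decidable P → ∃ P → ∃[ i ] P i × (∀ {j} → P j → toℕ i ≤ toℕ j)
least {zero} P? (() , _)
least {suc n} {P} P? (i , pi) with P? zero
... | yes p0 = zero , p0 , λ _ → z≤n
... | no ¬p0 = suc (proj₁ rest) , proj₁ (proj₂ rest) , minimal
  where
  tail : (i : Fin (suc n)) → P i → ∃ (P ∘ suc)
  tail zero    p0 = contradiction p0 ¬p0
  tail (suc i) pi = i , pi
  rest = least (P? ∘ suc) (tail i pi)
  minimal : ∀ {j} → P j → toℕ (suc (proj₁ rest)) ≤ toℕ j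
  minimal {zero}  p0 = contradiction p0 ¬p0
  minimal {suc j} pj = s≤s (proj₂ (proj₂ rest) pj)

parity : ℕ → Fin 2
parity zero          = zero
parity (suc zero)    = suc zero
parity (suc (suc m)) = parity m

parity-injective : ∀ {m n} → m ≤ suc n → n ≤ suc m → parity m ≡ parity n → m ≡ n
parity-injective {zero}        {zero}        _         _         _  = refl
parity-injective {zero}        {suc zero}    _         _         ()
parity-injective {zero}        {suc (suc _)} _         (s≤s ())  _
parity-injective {suc zero}    {zero}        _         _         ()
parity-injective {suc zero}    {suc zero}    _         _         _  = refl
parity-injective {suc (suc _)} {zero}        (s≤s ())  _         _
parity-injective {suc zero}    {suc (suc zero)}    _ _ ()
parity-injective {suc zero}    {suc (suc (suc _))} _ (s≤s (s≤s ())) _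
parity-injective {suc (suc zero)}    {suc zero}    _ _ ()
parity-injective {suc (suc (suc _))} {suc zero}    (s≤s (s≤s ())) _ _
parity-injective {suc (suc _)} {suc (suc _)} (s≤s (s≤s p)) (s≤s (s≤s q)) eq =
  cong (2 +_) (parity-injective p q eq)

-- Bounds the distance from `x` to the tips of a model with `suc n` branch sets and tip separation
-- `ρ`. Adding a layer spends 20 of the separation, since two climbs that meet would join their tips
-- in 10 + 10 steps; the new tip lies at distance at most `suc q`, with `q` as in `AddRoot`.
radius : ℕ → ℕ → ℕ
radius zero    ρ = 0
radius (suc n) ρ = suc (radius n (ρ + 20) + ρ + 12)

-- Bounded distance and reachability.

module _ (G : Graph) where

  data Within : ℕ → V G → V G → Set where
    here  : ∀ {k x} → Within k x x
    there : ∀ {k x y z} → Adj G x y → Within k y z → Within (suc k) x z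

  Reach : V G → V G → Set
  Reach = Star (Adj G)

module _ {G : Graph} where

  within-weaken : ∀ {x y} → k ≤ l → Within G k x y → Within G l x y
  within-weaken _         here        = here
  within-weaken (s≤s k≤l) (there e w) = there e (within-weaken k≤l w)

  within-trans : ∀ {x y z} → Within G k x y → Within G l y z → Within G (k + l) x z
  within-trans {k} {l} here v        = within-weaken (m≤n+m l k) v
  within-trans         (there e w) v = there e (within-trans w v)

  within-sym : ∀ {x y} → Within G k x y → Within G k y x
  within-sym here = here
  within-sym {suc k} {x} {y} (there e w) =
    subst (λ m → Within G m y x) (+-comm k 1) (within-trans (within-sym w) (there (adj-sym G e) here))

  within? : ∀ k x y → Dec (Within G k x y)
  within? k x y with x ≟ᶠ y
  within? k       x x | yes refl = yes here
  within? zero    x y | no x≢y = no λ { here → x≢y refl }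
  within? (suc k) x z | no x≢z =
    map′ (λ { (_ , e , w) → there e w })
         (λ { here → contradiction refl x≢z ; (there e w) → _ , e , w })
         (any? (λ y → adj? G x y ×-dec within? k y z))

  walk⇒within : ∀ {x y} → Walk G x y k → Within G k x y
  walk⇒within done       = here
  walk⇒within (step e w) = there e (walk⇒within w)

  within⇒walk : ∀ {x y} → Within G k x y → ∃[ m ] m ≤ k × Walk G x y m
  within⇒walk here = 0 , z≤n , done
  within⇒walk (there e w) with m , m≤k , v ← within⇒walk w = suc m , s≤s m≤k , step e v

  within⇒reach : ∀ {x y} → Within G k x y → Reach G x y
  within⇒reach here        = ε
  within⇒reach (there e w) = e ◅ within⇒reach w

  walk⇒reach : ∀ {x y} → Walk G x y k → Reach G x y
  walk⇒reach = within⇒reach ∘ walk⇒within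

  reach⇒walk : ∀ {x y} → Reach G x y → ∃[ k ] Walk G x y k
  reach⇒walk ε = 0 , done
  reach⇒walk (e ◅ p) with k , w ← reach⇒walk p = suc k , step e w

  reach-sym : ∀ {x y} → Reach G x y → Reach G y x
  reach-sym = Star.reverse (adj-sym G)

  shortest-walk : ∀ {x y} → Reach G x y →
    ∃[ k ] Walk G x y k × (∀ {m} → Walk G x y m → k ≤ m)
  shortest-walk {x} {y} p with dist G x y | dist-isDistance G x y
  ... | _ | finite w minimal = _ , w , minimal
  ... | _ | infinite none    = contradiction (proj₂ (reach⇒walk p)) none

  dist-≤ : ∀ {x y} → Within G k x y → dist G x y ≤⁺ [ k ]
  dist-≤ {x = x} {y} w with dist G x y | dist-isDistance G x y | within⇒walk w
  ... | _ | finite _ minimal | _ , m≤k , v = [ ≤-trans (minimal v) m≤k ]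
  ... | _ | infinite none    | _ , _ , v   = contradiction v none

  dist-> : ∀ {x y} → ¬ Within G k x y → [ k ] <⁺ dist G x y
  dist-> {k} {x} {y} far with dist G x y | dist-isDistance G x y
  ... | _ | finite w _ = [ ≰⇒> (λ m≤k → far (within-weaken m≤k (walk⇒within w))) ]
  ... | _ | infinite _ = [ k ]<⊤⁺

-- Components and breadth-first layerings.

module _ (G : Graph) where

  reach? : ∀ x y → Dec (Reach G x y)
  reach? x y with dist G x y | dist-isDistance G x y
  ... | _ | finite w _    = yes (walk⇒reach w)
  ... | _ | infinite none = no λ p → none (proj₂ (reach⇒walk p))

  class : V G → VSet G
  class x = ⟦ reach? x ⟧

  class-≡ : ∀ {x y} → Reach G x y → class x ≡ class y
  class-≡ {x} {y} p = ⊆-antisym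
    (λ q → ∈⟦⟧⁺ (reach? y) (reach-sym {G = G} p ◅◅ ∈⟦⟧⁻ (reach? x) q))
    (λ q → ∈⟦⟧⁺ (reach? x) (p ◅◅ ∈⟦⟧⁻ (reach? y) q))

  opaque
    private
      -- The least vertex of a component depends on the component alone, so all its vertices get the
      -- same root.
      least-reachable : ∀ x → ∃[ r ] Reach G x r × (∀ {y} → Reach G x y → toℕ r ≤ toℕ y)
      least-reachable x = least (reach? x) (x , ε)

      to-root : ∀ x → ∃[ k ] Walk G x (proj₁ (least-reachable x)) k ×
                  (∀ {m} → Walk G x (proj₁ (least-reachable x)) m → k ≤ m)
      to-root x = shortest-walk (proj₁ (proj₂ (least-reachable x)))

    root : V G → V G
    root x = proj₁ (least-reachable x)

    level : V G → ℕ
    level x = proj₁ (to-root x)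

    level-walk : ∀ x → Walk G x (root x) (level x)
    level-walk x = proj₁ (proj₂ (to-root x))

    level-minimal : ∀ x {m} → Walk G x (root x) m → level x ≤ m
    level-minimal x = proj₂ (proj₂ (to-root x))

    root-cong : ∀ {x y} → Reach G x y → root x ≡ root y
    root-cong {x} {y} p
      with _ , x↝r , r-min ← least-reachable x | _ , y↝s , s-min ← least-reachable y
      = toℕ-injective (≤-antisym (r-min (p ◅◅ y↝s)) (s-min (reach-sym {G = G} p ◅◅ x↝r)))

module _ {G : Graph} where

  level-within : ∀ {x y} → Within G k x y → level G x ≤ k + level G y
  level-within {k} {x} {y} w
    with m , m≤ , v ← within⇒walk (within-trans w (walk⇒within (level-walk G y)))
    = ≤-trans (level-minimal G x (subst (λ r → Walk G x r m) (sym (root-cong G (within⇒reach w))) v)) m≤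

  level-adj : ∀ {x y} → Adj G x y → level G x ≤ suc (level G y)
  level-adj e = level-within (there e here)

  level-root : ∀ x → level G (root G x) ≡ 0
  level-root x = n≤0⇒n≡0 (level-minimal G (root G x)
    (subst (λ r → Walk G (root G x) r 0) (root-cong G (walk⇒reach (level-walk G x))) done))

  level-zero : ∀ {x} → level G x ≡ 0 → x ≡ root G x
  level-zero {x} eq with level G x | level-walk G x
  level-zero refl | _ | w = end w
    where
    end : ∀ {x y} → Walk G x y 0 → x ≡ y
    end done = refl

  -- Take the first step of a shortest walk to the root: the rest of the walk bounds the level of
  -- `y` from above, `level-adj` from below.
  parent : ∀ {x i} → level G x ≡ suc i → ∃[ y ] Adj G x y × level G y ≡ i
  parent {x} {i} eq with step {y = y} e w ← subst (Walk G x (root G x)) eq (level-walk G x)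
    = y , e , ≤-antisym
        (level-minimal G y (subst (λ r → Walk G y r i) (root-cong G (e ◅ ε)) w))
        (≤-pred (≤-trans (≤-reflexive (sym eq)) (level-adj e)))

-- Induced subgraphs.

_⟨_⟩ : (H : Graph) → VSet H → Graph
H ⟨ S ⟩ = record
  { order   = order H
  ; Adj     = λ x y → x ∈ S × y ∈ S × Adj H x y
  ; adj?    = λ x y → (x ∈? S) ×-dec (y ∈? S) ×-dec adj? H x y
  ; adj-sym = λ { (x∈ , y∈ , e) → y∈ , x∈ , adj-sym H e }
  ; no-loop = λ { x (_ , _ , e) → no-loop H x e }
  }

module _ {H : Graph} where

  reach-mono : ∀ {S T : VSet H} → S ⊆ T → ∀ {x y} → Reach (H ⟨ S ⟩) x y → Reach (H ⟨ T ⟩) x y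
  reach-mono S⊆T = Star.map λ { (x∈ , y∈ , e) → S⊆T x∈ , S⊆T y∈ , e }

  -- `H ⟨ S ⟩` keeps all vertices of `H`, those outside `S` being isolated, so the empty path has to
  -- be excluded.
  reach-source : ∀ {S : VSet H} {x y} → x ≢ y → Reach (H ⟨ S ⟩) x y → x ∈ S
  reach-source x≢x ε                  = contradiction refl x≢x
  reach-source _   ((x∈ , _ , _) ◅ _) = x∈

  centered⇒connected : ∀ {S : VSet H} {c} → c ∈ S →
    (∀ {w} → w ∈ S → Reach (H ⟨ S ⟩) c w) → Connected H S
  centered⇒connected {S} {c} c∈ star = (c , c∈) , λ x∈ y∈ → reach-sym {G = H ⟨ S ⟩} (star x∈) ◅◅ star y∈

-- The region metric and its strips.

module Regions (H : Graph) {N : ℕ} (R : Fin N → VSet H) (R-connected : ∀ u → Connected H (R u)) where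

  -- The intersection graph of the regions restricted to A, seen from the vertices of H: one step
  -- stays inside one connected piece of some R u ∩ A.
  Γ : VSet H → Graph
  Γ A = record
    { order   = order H
    ; Adj     = λ x y → x ≢ y × ∃[ u ] Reach (H ⟨ R u ∩ A ⟩) x y
    ; adj?    = λ x y → ¬? (x ≟ᶠ y) ×-dec any? (λ u → reach? (H ⟨ R u ∩ A ⟩) x y)
    ; adj-sym = λ { (x≢y , u , p) → (x≢y ∘ sym) , u , reach-sym {G = H ⟨ R u ∩ A ⟩} p }
    ; no-loop = λ { _ (x≢x , _) → x≢x refl }
    }

  lev : VSet H → V H → ℕ
  lev A = level (Γ A)

  rt : VSet H → V H → V H
  rt A = root (Γ A)

  private
    variable
      A B : VSet H
      x y z : V H

  ∩-monoʳ : ∀ (T : VSet H) → A ⊆ B → T ∩ A ⊆ T ∩ B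
  ∩-monoʳ T A⊆B x∈ with x∈T , x∈A ← x∈p∩q⁻ T _ x∈ = x∈p∩q⁺ (x∈T , A⊆B x∈A)

  Γ-mono : A ⊆ B → Adj (Γ A) x y → Adj (Γ B) x y
  Γ-mono A⊆B (x≢y , u , p) = x≢y , u , reach-mono {H} (∩-monoʳ (R u) A⊆B) p

  within-mono : A ⊆ B → Within (Γ A) k x y → Within (Γ B) k x y
  within-mono A⊆B here        = here
  within-mono A⊆B (there e w) = there (Γ-mono A⊆B e) (within-mono A⊆B w)

  ⊆⊤ : A ⊆ ⊤
  ⊆⊤ _ = ∈⊤

  piece : ∀ u → Reach (H ⟨ R u ∩ A ⟩) x y → Within (Γ A) 1 x y
  piece {x = x} {y = y} u p with x ≟ᶠ y
  ... | yes refl = here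
  ... | no x≢y   = there (x≢y , u , p) here

  region-within : ∀ {u} → R u ⊆ A → x ∈ R u → y ∈ R u → Within (Γ A) 1 x y
  region-within {u = u} Ru⊆A x∈ y∈ =
    piece u (reach-mono {H} (λ z∈ → x∈p∩q⁺ (z∈ , Ru⊆A z∈)) (proj₂ (R-connected u) x∈ y∈))

  Γ-source : Adj (Γ A) x y → x ∈ A
  Γ-source {A} (x≢y , u , p) = proj₂ (x∈p∩q⁻ (R u) A (reach-source {H} x≢y p))

  reach-∈ : x ∈ A → Reach (Γ A) x y → y ∈ A
  reach-∈ x∈ ε = x∈
  reach-∈ {A = A} x∈ (e ◅ p) = reach-∈ (Γ-source (adj-sym (Γ A) e)) p

  -- Levels vary by at most one within a region contained in `A`. Such a region, if it meets level
  -- `ℓ`, therefore lies in the strip as a whole, and its connectedness is available again one layer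
  -- deeper.
  InStrip : VSet H → ℕ → V H → Set
  InStrip A ℓ z = z ∈ A × lev A z ≤ suc ℓ × ℓ ≤ suc (lev A z)

  inStrip? : ∀ A ℓ → Decidable (InStrip A ℓ)
  inStrip? A ℓ z = (z ∈? A) ×-dec (lev A z ≤? suc ℓ) ×-dec (ℓ ≤? suc (lev A z))

  strip : VSet H → ℕ → VSet H
  strip A ℓ = ⟦ inStrip? A ℓ ⟧

  strip⊆ : ∀ ℓ → strip A ℓ ⊆ A
  strip⊆ {A} ℓ x∈ = proj₁ (∈⟦⟧⁻ (inStrip? A ℓ) x∈)

  Slab : VSet H → ℕ → ℕ → VSet H → Set
  Slab A lo hi B = ∀ {y} → y ∈ A → lo ≤ lev A y → lev A y ≤ hi → y ∈ B

  -- Descending towards a root along regions.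

  record Segment (A : VSet H) (u : Fin N) (z : V H) (i : ℕ) : Set where
    field
      S         : VSet H
      start     : z ∈ S
      conn      : ∀ {w} → w ∈ S → Reach (H ⟨ S ⟩) z w
      inside    : ∀ {w} → w ∈ S → w ∈ R u × w ∈ A
      flat      : ∀ {w} → w ∈ S → lev A w ≡ suc i
      last exit : V H
      last∈     : last ∈ S
      exit∈     : exit ∈ R u × exit ∈ A
      last-exit : Adj H last exit
      exit-lev  : lev A exit ≡ i

  -- A step of `Γ A` to a parent is a path inside one region, cut here at its first vertex of level
  -- `i`. Until then the level stays at `suc i`: each vertex is within one step of `y` and of its
  -- predecessor on level `suc i`.
  segment-along : ∀ u {i} → Reach (H ⟨ R u ∩ A ⟩) z y → lev A z ≡ suc i → lev A y ≡ i → Segment A u z i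
  segment-along u ε hz hy = contradiction (trans (sym hz) hy) (λ ())
  segment-along {A} {z} {y} u {i} (_◅_ {j = w} e@(z∈ , w∈ , a) p) hz hy with lev A w ≟ i
  ... | yes hw = record
    { S = ⁅ z ⁆ ; start = x∈⁅x⁆ z
    ; conn = λ v∈ → subst (Reach (H ⟨ ⁅ z ⁆ ⟩) z) (sym (x∈⁅y⁆⇒x≡y z v∈)) ε
    ; inside = λ v∈ → subst (λ v → v ∈ R u × v ∈ A) (sym (x∈⁅y⁆⇒x≡y z v∈)) (x∈p∩q⁻ (R u) A z∈)
    ; flat = λ v∈ → trans (cong (lev A) (x∈⁅y⁆⇒x≡y z v∈)) hz
    ; last = z ; exit = w ; last∈ = x∈⁅x⁆ z ; exit∈ = x∈p∩q⁻ (R u) A w∈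
    ; last-exit = a ; exit-lev = hw }
  ... | no hw≢i = record
    { S = S′ ; start = z∈S′ ; conn = conn′ ; inside = inside′ ; flat = flat′
    ; last = T.last ; exit = T.exit ; last∈ = q⊆p∪q ⁅ z ⁆ T.S T.last∈
    ; exit∈ = T.exit∈ ; last-exit = T.last-exit ; exit-lev = T.exit-lev }
    where
    upper : lev A w ≤ suc i
    upper = subst (λ m → lev A w ≤ suc m) hy (level-within {G = Γ A} (piece u p))
    lower : i ≤ lev A w
    lower = ≤-pred (subst (_≤ suc (lev A w)) hz (level-within {G = Γ A} (piece u (e ◅ ε))))
    module T = Segment (segment-along {A} u p (≤-antisym upper (≤∧≢⇒< lower (hw≢i ∘ sym))) hy)
    S′ = ⁅ z ⁆ ∪ T.S
    z∈S′ = p⊆p∪q T.S (x∈⁅x⁆ z)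
    split : ∀ {P : V H → Set} → P z → (∀ {v} → v ∈ T.S → P v) → ∀ {v} → v ∈ S′ → P v
    split {P} pz pS v∈ with x∈p∪q⁻ ⁅ z ⁆ T.S v∈
    ... | inj₁ v∈z = subst P (sym (x∈⁅y⁆⇒x≡y z v∈z)) pz
    ... | inj₂ v∈S = pS v∈S
    conn′ : ∀ {v} → v ∈ S′ → Reach (H ⟨ S′ ⟩) z v
    conn′ = split {Reach (H ⟨ S′ ⟩) z} ε λ v∈ →
      (z∈S′ , q⊆p∪q ⁅ z ⁆ T.S T.start , a) ◅ reach-mono {H} (q⊆p∪q ⁅ z ⁆ T.S) (T.conn v∈)
    inside′ = split {λ v → v ∈ R u × v ∈ A} (x∈p∩q⁻ (R u) A z∈) T.inside
    flat′ = split {λ v → lev A v ≡ suc i} hz T.flat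

  segment : ∀ {i} → lev A z ≡ suc i → ∃[ u ] Segment A u z i
  segment {A} hz with y , (_ , u , p) , hy ← parent {G = Γ A} hz = u , segment-along u p hz hy

  module _ {u : Fin N} {i : ℕ} (seg : Segment A u z i) where
    open Segment seg

    segment-within : Slab A (suc i) (suc i) B → ∀ {w} → w ∈ S → Within (Γ B) 1 z w
    segment-within slab w∈ = piece u (reach-mono {H}
      (λ v∈ → let v∈R , v∈A = inside v∈ in
        x∈p∩q⁺ (v∈R , slab v∈A (≤-reflexive (sym (flat v∈))) (≤-reflexive (flat v∈))))
      (conn w∈))

    exit-within : Slab A i (suc i) B → Within (Γ B) 1 z exit
    exit-within {B} slab = piece u (reach-mono {H}
      (λ v∈ → let v∈R , v∈A = inside v∈ in
        x∈p∩q⁺ (v∈R , slab v∈A (≤-trans (n≤1+n i) (≤-reflexive (sym (flat v∈)))) (≤-reflexive (flat v∈))))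
      (conn last∈) ◅◅ (last′ , exit′ , last-exit) ◅ ε)
      where
      last′ : last ∈ R u ∩ B
      last′ = let v∈R , v∈A = inside last∈ in
        x∈p∩q⁺ (v∈R , slab v∈A (≤-trans (n≤1+n i) (≤-reflexive (sym (flat last∈)))) (≤-reflexive (flat last∈)))
      exit′ : exit ∈ R u ∩ B
      exit′ = let v∈R , v∈A = exit∈ in
        x∈p∩q⁺ (v∈R , slab v∈A (≤-reflexive (sym exit-lev)) (≤-trans (≤-reflexive exit-lev) (n≤1+n i)))

  -- One segment per level, down to `suc b`, so `S` misses level `b` and only `exit` reaches it.
  -- Distances are bounded in any `B` that contains the levels traversed, so that they can also be
  -- measured inside a strip; the extra step in `near` moves within the last segment.
  record Climb (A : VSet H) (z : V H) (b : ℕ) : Set where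
    field
      S         : VSet H
      start     : z ∈ S
      conn      : ∀ {w} → w ∈ S → Reach (H ⟨ S ⟩) z w
      inside    : S ⊆ A
      above     : ∀ {w} → w ∈ S → suc b ≤ lev A w
      near      : ∀ {B w} i → w ∈ S → lev A z ≤ i + lev A w → Slab A (lev A w) (lev A z) B →
                  Within (Γ B) (suc i) z w
      hits      : ∀ a → suc b ≤ a → a ≤ lev A z → ∃[ w ] w ∈ S × lev A w ≡ a
      last exit : V H
      last∈     : last ∈ S
      exit∈     : exit ∈ A
      last-exit : Adj H last exit
      exit-lev  : lev A exit ≡ b
      exit-near : ∀ {B} i → lev A z ≤ i + b → Slab A b (lev A z) B → Within (Γ B) i z exit

  climb-one : z ∈ A → lev A z ≡ suc n → Climb A z n
  climb-one {z} {A} {n} z∈A hz with u , seg ← segment hz = record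
    { S = seg.S ; start = seg.start ; conn = seg.conn
    ; inside = λ w∈ → proj₂ (seg.inside w∈)
    ; above = λ w∈ → ≤-reflexive (sym (seg.flat w∈))
    ; near = λ i w∈ _ slab → within-weaken (s≤s z≤n) (segment-within seg
        (λ y∈ lo hi → slab y∈ (≤-trans (≤-reflexive (seg.flat w∈)) lo) (≤-trans hi (≤-reflexive (sym hz))))
        w∈)
    ; hits = λ a lo hi → z , seg.start , trans hz (≤-antisym lo (≤-trans hi (≤-reflexive hz)))
    ; last = seg.last ; exit = seg.exit ; last∈ = seg.last∈ ; exit∈ = proj₂ seg.exit∈
    ; last-exit = seg.last-exit ; exit-lev = seg.exit-lev
    ; exit-near = λ i le slab → within-weaken
        (+-cancelʳ-≤ n 1 i (≤-trans (≤-reflexive (sym hz)) le))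
        (exit-within seg (λ y∈ lo hi → slab y∈ lo (≤-trans hi (≤-reflexive (sym hz)))))
    }
    where module seg = Segment seg

  climb-further : suc n ≤ lev A z → Climb A z (suc n) → Climb A z n
  climb-further {n} {A} {z} n<hz C
    with u , seg ← segment (Climb.exit-lev C) = record
    { S = S′ ; start = p⊆p∪q seg.S C.start
    ; conn = conn′
    ; inside = split {_∈ A} C.inside (λ w∈ → proj₂ (seg.inside w∈))
    ; above = split {λ w → suc n ≤ lev A w} (λ w∈ → ≤-trans (n≤1+n _) (C.above w∈))
                (λ w∈ → ≤-reflexive (sym (seg.flat w∈)))
    ; near = λ {B} i w∈ → split {λ w → lev A z ≤ i + lev A w → Slab A (lev A w) (lev A z) B →
                                    Within (Γ B) (suc i) z w}
        (λ w∈ → C.near i w∈) (near-seg i) w∈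
    ; hits = hits′
    ; last = seg.last ; exit = seg.exit ; last∈ = q⊆p∪q C.S seg.S seg.last∈
    ; exit∈ = proj₂ seg.exit∈ ; last-exit = seg.last-exit ; exit-lev = seg.exit-lev
    ; exit-near = exit-near′
    }
    where
    module C = Climb C
    module seg = Segment seg
    S′ = C.S ∪ seg.S
    split : ∀ {P : V H → Set} → (∀ {v} → v ∈ C.S → P v) → (∀ {v} → v ∈ seg.S → P v) →
            ∀ {v} → v ∈ S′ → P v
    split pC pS v∈ with x∈p∪q⁻ C.S seg.S v∈
    ... | inj₁ v∈C = pC v∈C
    ... | inj₂ v∈S = pS v∈S
    bridge : Adj (H ⟨ S′ ⟩) C.last C.exit
    bridge = p⊆p∪q seg.S C.last∈ , q⊆p∪q C.S seg.S seg.start , C.last-exit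
    conn′ : ∀ {v} → v ∈ S′ → Reach (H ⟨ S′ ⟩) z v
    conn′ = split {Reach (H ⟨ S′ ⟩) z} (λ v∈ → reach-mono {H} (p⊆p∪q seg.S) (C.conn v∈))
      (λ v∈ → reach-mono {H} (p⊆p∪q seg.S) (C.conn C.last∈) ◅◅ bridge ◅
              reach-mono {H} (q⊆p∪q C.S seg.S) (seg.conn v∈))
    near-seg : ∀ {B w} i → w ∈ seg.S → lev A z ≤ i + lev A w → Slab A (lev A w) (lev A z) B →
               Within (Γ B) (suc i) z w
    near-seg {B} {w} i w∈ le slab = subst (λ m → Within (Γ B) m z w) (+-comm i 1) (within-trans
      (C.exit-near i (subst (λ m → lev A z ≤ i + m) hw le)
        (λ y∈ lo hi → slab y∈ (≤-trans (≤-reflexive hw) lo) hi))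
      (segment-within seg (λ y∈ lo hi →
        slab y∈ (≤-trans (≤-reflexive hw) lo) (≤-trans hi n<hz)) w∈))
      where hw = seg.flat w∈
    hits′ : ∀ a → suc n ≤ a → a ≤ lev A z → ∃[ w ] w ∈ S′ × lev A w ≡ a
    hits′ a lo hi with suc n ≟ a
    ... | yes refl = C.exit , q⊆p∪q C.S seg.S seg.start , C.exit-lev
    ... | no n≢a with w , w∈ , hw ← C.hits a (≤∧≢⇒< lo n≢a) hi = w , p⊆p∪q seg.S w∈ , hw
    exit-near′ : ∀ {B} i → lev A z ≤ i + n → Slab A n (lev A z) B → Within (Γ B) i z seg.exit
    exit-near′ zero le _ = contradiction (≤-trans n<hz le) (n≮n n)
    exit-near′ {B} (suc i) le slab = subst (λ m → Within (Γ B) m z seg.exit) (+-comm i 1) (within-trans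
      (C.exit-near i (subst (lev A z ≤_) (sym (+-suc i n)) le)
        (λ y∈ lo hi → slab y∈ (≤-trans (n≤1+n n) lo) hi))
      (exit-within seg (λ y∈ lo hi → slab y∈ lo (≤-trans hi n<hz))))

  opaque
    climb : z ∈ A → n < lev A z → Climb A z n
    climb {z} {A} {n} z∈A n<hz with d , eq ← m≤n⇒∃[o]m+o≡n n<hz = go d n (trans (cong suc (+-comm d n)) eq)
      where
      go : ∀ d n → suc (d + n) ≡ lev A z → Climb A z n
      go zero    n eq = climb-one z∈A (sym eq)
      go (suc d) n eq = climb-further (≤-trans (s≤s (m≤n+m n (suc d))) (≤-reflexive eq))
        (go d (suc n) (trans (cong suc (+-suc d n)) eq))

  -- Balls around roots.

  InBall : VSet H → V H → ℕ → V H → Set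
  InBall A x b z = z ∈ A × lev A z ≤ b × rt A z ≡ rt A x

  inBall? : ∀ A x b → Decidable (InBall A x b)
  inBall? A x b z = (z ∈? A) ×-dec (lev A z ≤? b) ×-dec (rt A z ≟ᶠ rt A x)

  -- Centred at the root of `x`, not at `x`; comparing roots selects the component of `x`.
  ball : VSet H → V H → ℕ → VSet H
  ball A x b = ⟦ inBall? A x b ⟧

  root∈ball : ∀ b → x ∈ A → rt A x ∈ ball A x b
  root∈ball {x} {A} b x∈ = ∈⟦⟧⁺ (inBall? A x b)
    ( reach-∈ x∈ p
    , ≤-trans (≤-reflexive (level-root {G = Γ A} x)) z≤n
    , sym (root-cong (Γ A) p))
    where p = walk⇒reach (level-walk (Γ A) x)

  -- Segments lead from each vertex down to the root; they never rise and stay in the component,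
  -- hence in the ball.
  ball-connected : ∀ b → x ∈ A → Connected H (ball A x b)
  ball-connected {x} {A} b x∈ = centered⇒connected {H} (root∈ball b x∈)
    λ w∈ → reach-sym {G = H ⟨ ball A x b ⟩} (to-root _ (∈⟦⟧⁻ (inBall? A x b) w∈) refl)
    where
    to-root : ∀ i {z} → InBall A x b z → lev A z ≡ i → Reach (H ⟨ ball A x b ⟩) z (rt A x)
    to-root zero {z} (_ , _ , rz) hz =
      subst (Reach (H ⟨ ball A x b ⟩) z) (trans (level-zero {G = Γ A} hz) rz) ε
    to-root (suc i) {z} (z∈ , hz≤b , rz) hz with u , seg ← segment hz =
      reach-mono {H} S⊆ (seg.conn seg.last∈)
        ◅◅ (S⊆ seg.last∈ , ∈⟦⟧⁺ (inBall? A x b) exit-in , seg.last-exit)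
        ◅ to-root i exit-in seg.exit-lev
      where
      module seg = Segment seg
      i<b : suc i ≤ b
      i<b = subst (_≤ b) hz hz≤b
      S⊆ : seg.S ⊆ ball A x b
      S⊆ w∈ = ∈⟦⟧⁺ (inBall? A x b)
        ( proj₂ (seg.inside w∈)
        , ≤-trans (≤-reflexive (seg.flat w∈)) i<b
        , trans (sym (root-cong (Γ A) (within⇒reach (segment-within seg (λ y∈ _ _ → y∈) w∈)))) rz)
      exit-in : InBall A x b seg.exit
      exit-in = proj₂ seg.exit∈ , ≤-trans (≤-reflexive seg.exit-lev) (≤-trans (n≤1+n i) i<b) ,
        trans (sym (root-cong (Γ A) (within⇒reach (exit-within seg (λ y∈ _ _ → y∈))))) rz

  -- Minor models with separated tips.

  crossing : ∀ q {j} → Within (Γ ⊤) q x z → Walk (Γ A) z y j → ¬ Within (Γ ⊤) q x y →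
    ∃[ p ] ∃[ i ] ∃[ i′ ] Walk (Γ A) z p i × Walk (Γ A) p y i′ × i + i′ ≡ j ×
      Within (Γ ⊤) (suc q) x p × ¬ Within (Γ ⊤) q x p
  crossing q near done far = contradiction near far
  crossing {x = x} {A = A} q near (step {y = w} e v) far with within? {G = Γ ⊤} q x w
  -- Here the walk leaves the ball of radius `q` for the first time: the predecessor of `w` is
  -- inside, hence the bound `suc q`.
  ... | no far-w = w , 1 , _ , step e done , v , refl
                 , subst (λ m → Within (Γ ⊤) m x w) (+-comm q 1)
                     (within-trans near (there (Γ-mono {A} ⊆⊤ e) here))
                 , far-w
  ... | yes near-w with p , i , i′ , v₁ , v₂ , eq , near-p , far-p ← crossing q near-w v far
    = p , suc i , i′ , step e v₁ , v₂ , cong suc eq , near-p , far-p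

  -- A K n minor in H[A] whose branch sets carry tips: no other branch set meets the 3-ball of a tip
  -- in Γ A, whereas the distances between tips and from x are taken in the whole Γ ⊤.
  record Model (A : VSet H) (x : V H) (n ρ L : ℕ) : Set where
    field
      U         : Fin n → VSet H
      connected : ∀ i → Connected H (U i)
      disjoint  : ∀ {i j z} → z ∈ U i → z ∈ U j → i ≡ j
      joined    : ∀ {i j} → i ≢ j → ∃[ a ] ∃[ b ] a ∈ U i × b ∈ U j × Adj H a b
      inside    : ∀ i → U i ⊆ A
      tip       : Fin n → V H
      tip∈      : ∀ i → tip i ∈ U i
      isolated  : ∀ {i j w} → Within (Γ A) 3 (tip i) w → w ∈ U j → i ≡ j
      apart     : ∀ {i j} → Within (Γ ⊤) ρ (tip i) (tip j) → i ≡ j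
      local     : ∀ i → Within (Γ ⊤) L x (tip i)
      reach     : ∀ i → Reach (Γ A) x (tip i)

  model-one : x ∈ A → Model A x 1 n 0
  model-one {x} {A} x∈ = record
    { U = λ _ → ⁅ x ⁆
    ; connected = λ _ → centered⇒connected {H} (x∈⁅x⁆ x)
        (λ w∈ → subst (Reach (H ⟨ ⁅ x ⁆ ⟩) x) (sym (x∈⁅y⁆⇒x≡y x w∈)) ε)
    ; disjoint = λ { {zero} {zero} _ _ → refl }
    ; joined = λ { {zero} {zero} 0≢0 → contradiction refl 0≢0 }
    ; inside = λ _ w∈ → subst (_∈ A) (sym (x∈⁅y⁆⇒x≡y x w∈)) x∈
    ; tip = λ _ → x
    ; tip∈ = λ _ → x∈⁅x⁆ x
    ; isolated = λ { {zero} {zero} _ _ → refl }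
    ; apart = λ { {zero} {zero} _ → refl }
    ; local = λ _ → here
    ; reach = λ _ → ε
    }

  -- Adding the ball around a root as a branch set.

  module AddRoot {A : VSet H} {x : V H} {n ρ L : ℕ} (x∈A : x ∈ A)
    (M : Model (strip A (lev A x)) x n (ρ + 20) L)
    (deep : ¬ Within (Γ ⊤) (L + ρ + 12) x (rt A x)) where

    open Model M

    private
      A′ = strip A (lev A x)
      -- The new tip `p` will be further than `q` from `x`, while the other new tips are within
      -- `L + 7`; so `p` is further than `ρ` from them. Also `12 ≤ q` puts at least 13 steps between
      -- `x` and `p`, which brings `p` down to level `b` - 4 or lower.
      q  = L + ρ + 12

      12≤q : 12 ≤ q
      12≤q = m≤n+m 12 (L + ρ)

      q<walk : ∀ {y i} → Walk (Γ A) x y i → ¬ Within (Γ ⊤) q x y → q < i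
      q<walk v far = ≰⇒> λ i≤q → far (within-weaken i≤q (within-mono {A} ⊆⊤ (walk⇒within v)))

      q<level : q < lev A x
      q<level = q<walk (level-walk (Γ A) x) deep

      -- The old branch sets have levels ≥ 8 + b, their new tips level 4 + b, the new branch set levels
      -- ≤ b and its tip level ≤ b − 4; these gaps exceed the isolation radius 3.
      opaque
        base : ∃[ b ] 9 + b ≡ lev A x
        base = m≤n⇒∃[o]m+o≡n (≤-trans (m≤m+n 9 4) (≤-trans (s≤s 12≤q) q<level))

      b = proj₁ base

      b≡ : 9 + b ≡ lev A x
      b≡ = proj₂ base

      opaque
        -- The root is further than `q` from `x`, so the geodesic of `Γ A` towards it leaves the
        -- ball of radius `q` of `Γ ⊤`; `p` is the first vertex outside.
        new-tip : ∃[ p ] p ∈ A × rt A p ≡ rt A x × 4 + lev A p ≤ b × Reach (Γ A) x p ×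
                  Within (Γ ⊤) (suc q) x p × ¬ Within (Γ ⊤) q x p
        new-tip with p , i , i′ , v₁ , v₂ , eq , near-p , far-p ←
                     crossing q here (level-walk (Γ A) x) deep
          = p , reach-∈ x∈A x↝p , sym (root-cong (Γ A) x↝p) , bound , x↝p , near-p , far-p
          where
          x↝p : Reach (Γ A) x p
          x↝p = walk⇒reach v₁
          bound : 4 + lev A p ≤ b
          bound = +-cancelˡ-≤ 9 _ _ (begin
            13 + lev A p ≤⟨ +-mono-≤ (≤-trans (s≤s 12≤q) (q<walk v₁ far-p))
                              (level-minimal (Γ A) p (subst (λ r → Walk (Γ A) p r i′) (root-cong (Γ A) x↝p) v₂)) ⟩
            i + i′       ≡⟨ eq ⟩
            lev A x      ≡⟨ b≡ ⟨
            9 + b        ∎)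
            where open ≤-Reasoning

      p = proj₁ new-tip
      p-low = proj₁ (proj₂ (proj₂ (proj₂ new-tip)))
      x↝p = proj₁ (proj₂ (proj₂ (proj₂ (proj₂ new-tip))))
      p-near = proj₁ (proj₂ (proj₂ (proj₂ (proj₂ (proj₂ new-tip)))))
      p-far = proj₂ (proj₂ (proj₂ (proj₂ (proj₂ (proj₂ new-tip)))))

      in-strip : ∀ {i z} → z ∈ U i → InStrip A (lev A x) z
      in-strip {i} z∈ = ∈⟦⟧⁻ (inStrip? A (lev A x)) (inside i z∈)

      U-high : ∀ {i z} → z ∈ U i → 8 + b ≤ lev A z
      U-high z∈ = ≤-pred (≤-trans (≤-reflexive b≡) (proj₂ (proj₂ (in-strip z∈))))

      tip-low : ∀ i → lev A (tip i) ≤ 10 + b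
      tip-low i = ≤-trans (proj₁ (proj₂ (in-strip (tip∈ i)))) (s≤s (≤-reflexive (sym b≡)))

      tip∈A : ∀ i → tip i ∈ A
      tip∈A i = proj₁ (in-strip (tip∈ i))

      reach-A : ∀ i → Reach (Γ A) x (tip i)
      reach-A i = Star.map (Γ-mono (strip⊆ (lev A x))) (reach i)

      opaque
        descent : ∀ i → Climb A (tip i) b
        descent i = climb (tip∈A i) (≤-trans (m≤n+m (suc b) 7) (U-high (tip∈ i)))

      module C (i : Fin n) = Climb (descent i)

      opaque
        mid : ∀ i → ∃[ w ] w ∈ C.S i × lev A w ≡ 4 + b
        mid i = C.hits i (4 + b) (m≤n+m (suc b) 3) (≤-trans (m≤n+m (4 + b) 4) (U-high (tip∈ i)))

      -- Old tips have level at most `10 + b`, so a climb drops by at most 9 levels in all and by at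
      -- most 6 down to `mid`; with the extra step of `near` this gives the constants 10 and 7.
      near-tip : ∀ {i w} k → w ∈ C.S i → 10 + b ≤ k + lev A w → Within (Γ A) (suc k) (tip i) w
      near-tip {i} k w∈ le = C.near i k w∈ (≤-trans (tip-low i) le) (λ y∈ _ _ → y∈)

      near-path : ∀ {i w} → w ∈ C.S i → Within (Γ A) 10 (tip i) w
      near-path {i} w∈ = near-tip 9 w∈ (≤-trans (≤-reflexive (sym (+-suc 9 b))) (+-monoʳ-≤ 9 (C.above i w∈)))

      near-mid : ∀ i → Within (Γ A) 7 (tip i) (proj₁ (mid i))
      near-mid i = near-tip 6 (proj₁ (proj₂ (mid i))) (≤-reflexive (cong (6 +_) (sym (proj₂ (proj₂ (mid i))))))

      tips-apart : ∀ {i j} k → k ≤ ρ + 20 → Within (Γ A) k (tip i) (tip j) → i ≡ j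
      tips-apart k k≤ w = apart (within-weaken k≤ (within-mono {A} ⊆⊤ w))

      -- U j lies in the strip and levels only decrease along a climb, so the climb reaches a point of
      -- U j inside the strip, within three steps of tip i.
      path-U : ∀ {i j w} → w ∈ C.S i → w ∈ U j → i ≡ j
      path-U {i} {j} {w} w∈S w∈U = isolated (C.near i 2 w∈S
        (≤-trans (tip-low i) (+-monoʳ-≤ 2 (U-high w∈U)))
        (λ y∈ lo hi → ∈⟦⟧⁺ (inStrip? A (lev A x))
          ( y∈
          , ≤-trans hi (≤-trans (tip-low i) (s≤s (≤-reflexive b≡)))
          , ≤-trans (≤-reflexive (sym b≡)) (s≤s (≤-trans (U-high w∈U) lo))))) w∈U

      path-path : ∀ {i j w} → w ∈ C.S i → w ∈ C.S j → i ≡ j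
      path-path w∈i w∈j = tips-apart 20 (m≤n+m 20 ρ)
        (within-trans (near-path w∈i) (within-sym (near-path w∈j)))

      U⁺ : Fin (suc n) → VSet H
      U⁺ zero    = ball A x b
      U⁺ (suc i) = U i ∪ C.S i

      ∪-elim : ∀ {P : V H → Set} i → (∀ {v} → v ∈ U i → P v) → (∀ {v} → v ∈ C.S i → P v) →
               ∀ {v} → v ∈ U⁺ (suc i) → P v
      ∪-elim i pU pS v∈ with x∈p∪q⁻ (U i) (C.S i) v∈
      ... | inj₁ v∈U = pU v∈U
      ... | inj₂ v∈S = pS v∈S

      U⊆ : ∀ i → U i ⊆ U⁺ (suc i)
      U⊆ i = p⊆p∪q (C.S i)

      S⊆ : ∀ i → C.S i ⊆ U⁺ (suc i)
      S⊆ i = q⊆p∪q (U i) (C.S i)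

      above : ∀ {i w} → w ∈ U⁺ (suc i) → suc b ≤ lev A w
      above {i} = ∪-elim {λ w → suc b ≤ lev A w} i
        (λ w∈ → ≤-trans (m≤n+m (suc b) 7) (U-high w∈)) (C.above i)

      below : ∀ {w} → w ∈ U⁺ zero → lev A w ≤ b
      below w∈ = proj₁ (proj₂ (∈⟦⟧⁻ (inBall? A x b) w∈))

      -- The tip is reachable from `x`, so the exit has the same root as `x`. This makes the new
      -- branch set adjacent to every old one.
      exit∈ball : ∀ i → C.exit i ∈ U⁺ zero
      exit∈ball i = ∈⟦⟧⁺ (inBall? A x b)
        ( C.exit∈ i
        , ≤-reflexive (C.exit-lev i)
        , sym (root-cong (Γ A) (reach-A i ◅◅ within⇒reach (C.exit-near i 10 (tip-low i) (λ y∈ _ _ → y∈)))))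

      connected⁺ : ∀ i → Connected H (U⁺ i)
      connected⁺ zero = ball-connected b x∈A
      connected⁺ (suc i) = centered⇒connected {H} (U⊆ i (tip∈ i)) (∪-elim {Reach (H ⟨ U⁺ (suc i) ⟩) (tip i)} i
        (λ v∈ → reach-mono {H} (U⊆ i) (proj₂ (connected i) (tip∈ i) v∈))
        (λ v∈ → reach-mono {H} (S⊆ i) (C.conn i v∈)))

      disjoint⁺ : ∀ {i j z} → z ∈ U⁺ i → z ∈ U⁺ j → i ≡ j
      disjoint⁺ {zero} {zero} _ _ = refl
      disjoint⁺ {zero} {suc j} z∈ z∈′ = contradiction (≤-trans (above z∈′) (below z∈)) (n≮n b)
      disjoint⁺ {suc i} {zero} z∈ z∈′ = contradiction (≤-trans (above z∈) (below z∈′)) (n≮n b)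
      disjoint⁺ {suc i} {suc j} {z} z∈ z∈′ =
        cong suc (cases (x∈p∪q⁻ (U i) (C.S i) z∈) (x∈p∪q⁻ (U j) (C.S j) z∈′))
        where
        cases : z ∈ U i ⊎ z ∈ C.S i → z ∈ U j ⊎ z ∈ C.S j → i ≡ j
        cases (inj₁ z∈) (inj₁ z∈′) = disjoint z∈ z∈′
        cases (inj₁ z∈) (inj₂ z∈′) = sym (path-U z∈′ z∈)
        cases (inj₂ z∈) (inj₁ z∈′) = path-U z∈ z∈′
        cases (inj₂ z∈) (inj₂ z∈′) = path-path z∈ z∈′

      joined⁺ : ∀ {i j} → i ≢ j → ∃[ a ] ∃[ b ] a ∈ U⁺ i × b ∈ U⁺ j × Adj H a b
      joined⁺ {zero} {zero} 0≢0 = contradiction refl 0≢0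
      joined⁺ {zero} {suc j} _ =
        C.exit j , C.last j , exit∈ball j , S⊆ j (C.last∈ j) , adj-sym H (C.last-exit j)
      joined⁺ {suc i} {zero} _ =
        C.last i , C.exit i , S⊆ i (C.last∈ i) , exit∈ball i , C.last-exit i
      joined⁺ {suc i} {suc j} i≢j with c , d , c∈ , d∈ , e ← joined (i≢j ∘ cong suc) =
        c , d , U⊆ i c∈ , U⊆ j d∈ , e

      inside⁺ : ∀ i → U⁺ i ⊆ A
      inside⁺ zero w∈ = proj₁ (∈⟦⟧⁻ (inBall? A x b) w∈)
      inside⁺ (suc i) = ∪-elim {_∈ A} i (λ w∈ → proj₁ (in-strip w∈)) (C.inside i)

      tip⁺ : Fin (suc n) → V H
      tip⁺ zero    = p
      tip⁺ (suc i) = proj₁ (mid i)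

      tip⁺-level : ∀ i → lev A (tip⁺ (suc i)) ≡ 4 + b
      tip⁺-level i = proj₂ (proj₂ (mid i))

      tip∈⁺ : ∀ i → tip⁺ i ∈ U⁺ i
      tip∈⁺ zero = ∈⟦⟧⁺ (inBall? A x b)
        (proj₁ (proj₂ new-tip) , ≤-trans (m≤n+m (lev A p) 4) p-low , proj₁ (proj₂ (proj₂ new-tip)))
      tip∈⁺ (suc i) = S⊆ i (proj₁ (proj₂ (mid i)))

      -- Level gaps decide all cases but that of a new tip close to a climb. There, 7 + 3 + 10 steps
      -- would join the two old tips, so the tips coincide.
      isolated⁺ : ∀ {i j w} → Within (Γ A) 3 (tip⁺ i) w → w ∈ U⁺ j → i ≡ j
      isolated⁺ {zero} {zero} _ _ = refl
      isolated⁺ {zero} {suc j} {w} near w∈ = contradiction (begin-strict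
        b                ≤⟨ n≤1+n b ⟩
        suc b            ≤⟨ above w∈ ⟩
        lev A w          ≤⟨ level-within {G = Γ A} (within-sym near) ⟩
        3 + lev A p      <⟨ p-low ⟩
        b                ∎) (n≮n b)
        where open ≤-Reasoning
      isolated⁺ {suc i} {zero} {w} near w∈ = contradiction (begin-strict
        3 + b                <⟨ ≤-reflexive (sym (tip⁺-level i)) ⟩
        lev A (tip⁺ (suc i)) ≤⟨ level-within {G = Γ A} near ⟩
        3 + lev A w          ≤⟨ +-monoʳ-≤ 3 (below w∈) ⟩
        3 + b                ∎) (n≮n (3 + b))
        where open ≤-Reasoning
      isolated⁺ {suc i} {suc j} {w} near w∈ with x∈p∪q⁻ (U j) (C.S j) w∈
      ... | inj₂ w∈S = cong suc (tips-apart 20 (m≤n+m 20 ρ)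
        (within-trans (within-trans (near-mid i) near) (within-sym (near-path w∈S))))
      -- Impossible even for `i ≡ j`: the new tip has left the strip that contains the old branch
      -- sets.
      ... | inj₁ w∈U = contradiction (begin-strict
        7 + b                        <⟨ U-high w∈U ⟩
        lev A w                      ≤⟨ level-within {G = Γ A} (within-sym near) ⟩
        3 + lev A (tip⁺ (suc i))     ≡⟨ cong (3 +_) (tip⁺-level i) ⟩
        7 + b                        ∎) (n≮n (7 + b))
        where open ≤-Reasoning

      mid-local : ∀ i → Within (Γ ⊤) (L + 7) x (tip⁺ (suc i))
      mid-local i = within-trans (local i) (within-mono {A} ⊆⊤ (near-mid i))

      p-mid : ∀ {i} → ¬ Within (Γ ⊤) ρ p (tip⁺ (suc i))
      p-mid {i} near = p-far (within-weaken (begin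
        L + 7 + ρ   ≡⟨ +-assoc L 7 ρ ⟩
        L + (7 + ρ) ≤⟨ +-monoʳ-≤ L (≤-trans (m≤n+m (7 + ρ) 5) (≤-reflexive (+-comm 12 ρ))) ⟩
        L + (ρ + 12) ≡⟨ +-assoc L ρ 12 ⟨
        q           ∎) (within-trans (mid-local i) (within-sym near)))
        where open ≤-Reasoning

      apart⁺ : ∀ {i j} → Within (Γ ⊤) ρ (tip⁺ i) (tip⁺ j) → i ≡ j
      apart⁺ {zero} {zero} _ = refl
      apart⁺ {zero} {suc j} near = ⊥-elim (p-mid near)
      apart⁺ {suc i} {zero} near = ⊥-elim (p-mid (within-sym near))
      -- Each tip has moved by at most 7, within the reserve of 20.
      apart⁺ {suc i} {suc j} near = cong suc (apart (within-weaken bound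
        (within-trans (within-trans (to-mid i) near) (within-sym (to-mid j)))))
        where
        to-mid : ∀ i → Within (Γ ⊤) 7 (tip i) (tip⁺ (suc i))
        to-mid i = within-mono {A} ⊆⊤ (near-mid i)
        bound : 7 + ρ + 7 ≤ ρ + 20
        bound = begin
          7 + ρ + 7 ≡⟨ cong (_+ 7) (+-comm 7 ρ) ⟩
          ρ + 7 + 7 ≡⟨ +-assoc ρ 7 7 ⟩
          ρ + 14    ≤⟨ +-monoʳ-≤ ρ (m≤m+n 14 6) ⟩
          ρ + 20    ∎
          where open ≤-Reasoning

      local⁺ : ∀ i → Within (Γ ⊤) (suc q) x (tip⁺ i)
      local⁺ zero = p-near
      local⁺ (suc i) = within-weaken (begin
        L + 7            ≤⟨ +-mono-≤ (m≤m+n L ρ) (m≤m+n 7 5) ⟩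
        q                ≤⟨ n≤1+n q ⟩
        suc q            ∎) (mid-local i)
        where open ≤-Reasoning

      reach⁺ : ∀ i → Reach (Γ A) x (tip⁺ i)
      reach⁺ zero    = x↝p
      reach⁺ (suc i) = reach-A i ◅◅ within⇒reach (near-mid i)

    model : Model A x (suc n) ρ (suc q)
    model = record
      { U = U⁺ ; connected = connected⁺ ; disjoint = disjoint⁺ ; joined = joined⁺
      ; inside = inside⁺ ; tip = tip⁺ ; tip∈ = tip∈⁺ ; isolated = isolated⁺
      ; apart = apart⁺ ; local = local⁺ ; reach = reach⁺ }

  -- Nested layerings, their roots and colors.

  roots : ∀ n → VSet H → V H → Vec (V H) n
  roots zero    A x = []
  roots (suc n) A x = rt A x ∷ roots n (strip A (lev A x)) x

  Near : ℕ → V H → V H → Set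
  Near = Within (Γ ⊤)

  x∈strip : x ∈ A → x ∈ strip A (lev A x)
  x∈strip {x} {A} x∈ = ∈⟦⟧⁺ (inStrip? A (lev A x)) (x∈ , n≤1+n _ , n≤1+n _)

  color : ∀ n → VSet H → V H → Fin (2 ^ n)
  color zero    A x = zero
  color (suc n) A x = combine (parity (lev A x)) (color n (strip A (lev A x)) x)

  -- Vertices of one region share the root, and their levels differ by at most one; equal parity
  -- makes the levels equal. The common strip contains all of `R u`, so the argument repeats inside
  -- it. Each root is settled before the parity of its layering is read, so the innermost layering
  -- costs no bit.
  same-roots : ∀ n {A u x y} → R u ⊆ A → x ∈ R u → y ∈ R u →
    color n A x ≡ color n A y → roots (suc n) A x ≡ roots (suc n) A y
  same-roots n {A} {u} {x} {y} Ru⊆A x∈ y∈ eq = cong₂ _∷_ (root-cong (Γ A) (within⇒reach near)) (rest n eq)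
    where
    near : Within (Γ A) 1 x y
    near = region-within Ru⊆A x∈ y∈
    rest : ∀ n → color n A x ≡ color n A y →
      roots n (strip A (lev A x)) x ≡ roots n (strip A (lev A y)) y
    rest zero _ = refl
    rest (suc n) eq = trans (same-roots n Ru⊆strip x∈ y∈ color-eq)
                            (cong (λ ℓ → roots (suc n) (strip A ℓ) y) lev-eq)
      where
      lev-eq : lev A x ≡ lev A y
      lev-eq = parity-injective (level-within {G = Γ A} near) (level-within {G = Γ A} (within-sym near))
        (combine-injectiveˡ (parity (lev A x)) _ (parity (lev A y)) _ eq)
      color-eq : color n (strip A (lev A x)) x ≡ color n (strip A (lev A x)) y
      color-eq = trans (combine-injectiveʳ (parity (lev A x)) _ (parity (lev A y)) _ eq)
        (cong (λ ℓ → color n (strip A ℓ) y) (sym lev-eq))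
      Ru⊆strip : R u ⊆ strip A (lev A x)
      Ru⊆strip z∈ = ∈⟦⟧⁺ (inStrip? A (lev A x))
        ( Ru⊆A z∈
        , level-within {G = Γ A} (region-within Ru⊆A z∈ x∈)
        , level-within {G = Γ A} (region-within Ru⊆A x∈ z∈))

  -- The recursion first builds the model inside the strip, with 20 extra units of separation for
  -- `AddRoot` to spend, then adds the root of `A`.
  model-far-from-roots : ∀ n ρ → x ∈ A → ¬ Any (Near (radius n ρ) x) (roots n A x) →
    Model A x (suc n) ρ (radius n ρ)
  model-far-from-roots zero ρ x∈ _ = model-one x∈
  model-far-from-roots {x} {A} (suc n) ρ x∈ far = AddRoot.model {A} {x} x∈
    (model-far-from-roots n (ρ + 20) (x∈strip x∈)
      (λ near → far (there (Any.map (within-weaken L≤) near))))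
    (λ near → far (here (within-weaken (n≤1+n _) near)))
    where
    L≤ : radius n (ρ + 20) ≤ radius (suc n) ρ
    L≤ = ≤-trans (≤-trans (m≤m+n _ ρ) (m≤m+n _ 12)) (n≤1+n _)

  model⇒minor : ∀ {L} → Model A x n l L → MinorModel (K n) H
  model⇒minor M = record
    { branch = U
    ; connected = connected
    ; disjoint = λ { {u} {v} u≢v (z , z∈) → let z∈u , z∈v = x∈p∩q⁻ (U u) (U v) z∈ in u≢v (disjoint z∈u z∈v) }
    ; joined = joined
    }
    where open Model M

  -- Separation 0 is enough for the outermost model, to which no further layer is added.
  covered : ∀ n → ¬ MinorModel (K (suc n)) H → ∀ x → Any (Near (radius n 0) x) (roots n ⊤ x)
  covered n no-minor x with Any.any? (within? {G = Γ ⊤} (radius n 0) x) (roots n ⊤ x)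
  ... | yes near = near
  ... | no far   = contradiction (model⇒minor (model-far-from-roots n 0 ∈⊤ far)) no-minor

-- Chains covered by few balls.

span : ℕ → ℕ → ℕ
span L zero    = 0
span L (suc n) = (span L n + 1 + L) + (span L n + 1 + L)

module _ {G : Graph} (L : ℕ) where

  Link : Vec (V G) n → V G → V G → Set
  Link qs x y = Within G 1 x y × Any (Within G L x) qs × Any (Within G L y) qs

  link-sym : {qs : Vec (V G) n} → ∀ {x y} → Link qs x y → Link qs y x
  link-sym (w , cx , cy) = within-sym w , cy , cx

  -- Before its first visit to the ball around `q`, the chain is covered by the other balls. The
  -- step into the ball is kept apart, as `v` may be covered by `q` only.
  first-near : ∀ q (qs : Vec (V G) n) {x y} → Star (Link (q ∷ qs)) x y →
    Star (Link qs) x y ⊎ (∃[ u ] ∃[ v ] Star (Link qs) x u × Within G 1 u v × Within G L v q)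
  first-near q qs ε = inj₁ ε
  first-near q qs (_◅_ {x} {y} (w , cx , cy) p)
    with within? {G = G} L x q | within? {G = G} L y q
  ... | yes near | _        = inj₂ (x , x , ε , here , near)
  ... | no _     | yes near = inj₂ (x , y , ε , w , near)
  ... | no x-far | no y-far with first-near q qs p
  ...   | inj₁ p′ = inj₁ ((w , Any.tail x-far cx , Any.tail y-far cy) ◅ p′)
  ...   | inj₂ (u , v , p′ , near) =
    inj₂ (u , v , (w , Any.tail x-far cx , Any.tail y-far cy) ◅ p′ , near)

  -- Follow the chain from either end to its first visit near `q`. Both initial parts are short by
  -- induction, and one step and `L` more lead to `q`; hence the two equal halves of `span`.
  -- Induction applies at once if `q` is never approached.
  link-within : (qs : Vec (V G) n) → ∀ {x y} → Star (Link qs) x y → Within G (span L n) x y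
  link-within [] ε = here
  link-within [] ((_ , () , _) ◅ _)
  link-within {suc n} (q ∷ qs) p with first-near q qs p | first-near q qs (Star.reverse link-sym p)
  ... | inj₁ p′ | _ = within-weaken (≤-trans (≤-trans (m≤m+n _ 1) (m≤m+n _ L)) (m≤m+n _ _)) (link-within qs p′)
  ... | inj₂ _ | inj₁ p′ =
    within-weaken (≤-trans (≤-trans (m≤m+n _ 1) (m≤m+n _ L)) (m≤m+n _ _)) (within-sym (link-within qs p′))
  ... | inj₂ (_ , _ , p₁ , e₁ , near₁) | inj₂ (_ , _ , p₂ , e₂ , near₂) =
    within-trans (within-trans (within-trans (link-within qs p₁) e₁) near₁)
      (within-sym (within-trans (within-trans (link-within qs p₂) e₂) near₂))

-- Monochromatic components as a partition.

module _ {G : Graph} {k : ℕ} (c : V G → Fin k) (δ : ℕ) where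

  Mono : Graph
  Mono = record
    { order   = order G
    ; Adj     = λ x y → x ≢ y × Within G δ x y × c x ≡ c y
    ; adj?    = λ x y → ¬? (x ≟ᶠ y) ×-dec within? {G = G} δ x y ×-dec (c x ≟ᶠ c y)
    ; adj-sym = λ { (x≢y , w , eq) → (x≢y ∘ sym) , within-sym w , sym eq }
    ; no-loop = λ { _ (x≢x , _) → x≢x refl }
    }

  mono-color : ∀ {x y} → Reach Mono x y → c x ≡ c y
  mono-color ε = refl
  mono-color ((_ , _ , eq) ◅ p) = trans eq (mono-color p)

  -- The parts are the components of `Mono`, sorted by color: vertices of one color at distance at
  -- most `δ` are linked, so distinct components of that color are further apart.
  components-partition : ∀ {D} → (∀ {x y} → Reach Mono x y → Within G D x y) →
    Σ (Family G) λ 𝓤 → IsPartition G 𝓤 × MultiDisjoint G k δ 𝓤 × (∀ {X} → 𝓤 X → DiameterAtMost G D X)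
  components-partition {D} bounded = 𝓤 , partition , (𝓤s , (forward , backward) , separated) , diameter
    where
    𝓤 : Family G
    𝓤 X = ∃[ u ] X ≡ class Mono u

    𝓤s : Fin k → Family G
    𝓤s i X = ∃[ u ] c u ≡ i × X ≡ class Mono u

    ∈class : ∀ {u x} → x ∈ class Mono u → Reach Mono u x
    ∈class {u} = ∈⟦⟧⁻ (reach? Mono u)

    self : ∀ u → u ∈ class Mono u
    self u = ∈⟦⟧⁺ (reach? Mono u) ε

    merge : ∀ {u v x y} → x ∈ class Mono u → y ∈ class Mono v → Reach Mono x y → class Mono u ≡ class Mono v
    merge x∈ y∈ p = class-≡ Mono (∈class x∈ ◅◅ p ◅◅ reach-sym {G = Mono} (∈class y∈))

    partition : IsPartition G 𝓤
    partition = record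
      { nonempty = λ { (u , refl) → u , self u }
      ; disjoint = λ { (u , refl) (v , refl) X≢Y (x , x∈) →
          let x∈u , x∈v = x∈p∩q⁻ (class Mono u) (class Mono v) x∈ in X≢Y (merge x∈u x∈v ε) }
      ; covers = λ v → class Mono v , (v , refl) , self v
      }

    forward : ∀ {X} → 𝓤 X → Σ (Fin k) λ i → 𝓤s i X
    forward (u , eq) = c u , u , refl , eq

    backward : ∀ {X} → (Σ (Fin k) λ i → 𝓤s i X) → 𝓤 X
    backward (_ , u , _ , eq) = u , eq

    separated : ∀ i → Disjoint G δ (𝓤s i)
    separated i (u , cu , refl) (v , cv , refl) X≢Y {x} {y} x∈ y∈ = dist-> λ near → X≢Y (merge x∈ y∈ (link near))
      where
      link : Within G δ x y → Reach Mono x y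
      link near with x ≟ᶠ y
      ... | yes refl = ε
      ... | no x≢y = (x≢y , near , trans (sym (mono-color (∈class x∈)))
                       (trans cu (trans (sym cv) (mono-color (∈class y∈))))) ◅ ε

    diameter : ∀ {X} → 𝓤 X → DiameterAtMost G D X
    diameter (u , refl) x∈ y∈ = dist-≤ (bounded (reach-sym {G = Mono} (∈class x∈) ◅◅ ∈class y∈))

-- Thickened regions and the transfer of distances.

module Thickened {G H : Graph} (M : RegionIntersectionModel G H) (δ : ℕ) where
  open RegionIntersectionModel M

  Touches : V G → V H → Set
  Touches u z = ∃[ v ] Within G δ u v × z ∈ μ v

  touches? : ∀ u → Decidable (Touches u)
  touches? u z = any? λ v → within? {G = G} δ u v ×-dec (z ∈? μ v)

  thick : V G → VSet H
  thick u = ⟦ touches? u ⟧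

  private
    -- A vertex of `G` is represented in `H` by one vertex of its region. If `w` is within `δ` of
    -- `u`, both centers lie in `thick u`, hence within one step of `Γ ⊤`.
    center : ∀ u → V H
    center u = proj₁ (proj₁ (connected u))

    center∈ : ∀ u → center u ∈ μ u
    center∈ u = proj₂ (proj₁ (connected u))

  common : ∀ {u v} → Adj G u v → Nonempty (μ u ∩ μ v)
  common {u} {v} e = Equivalence.from (intersects (λ { refl → no-loop G u e })) e

  shared : ∀ {u v z} → z ∈ μ u → z ∈ μ v → Within G 1 u v
  shared {u} {v} z∈u z∈v with u ≟ᶠ v
  ... | yes refl = here
  ... | no u≢v   = there (Equivalence.to (intersects u≢v) (_ , x∈p∩q⁺ (z∈u , z∈v))) here

  -- Consecutive regions along the walk intersect, so paths inside them can be concatenated.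
  reach-along : ∀ {S : VSet H} {m u v x z} → (∀ {w} → Within G m u w → μ w ⊆ S) → Within G m u v →
    x ∈ μ u → z ∈ μ v → Reach (H ⟨ S ⟩) x z
  reach-along sub here x∈ z∈ = reach-mono {H} (sub here) (proj₂ (connected _) x∈ z∈)
  reach-along {u = u} sub (there {y = w} e near) x∈ z∈
    with y , y∈ ← common e
    with y∈u , y∈w ← x∈p∩q⁻ (μ u) (μ w) y∈
    = reach-mono {H} (sub here) (proj₂ (connected u) x∈ y∈u)
      ◅◅ reach-along (λ near → sub (there e near)) near y∈w z∈

  μ⊆thick : ∀ {u v} → Within G δ u v → μ v ⊆ thick u
  μ⊆thick {u} near z∈ = ∈⟦⟧⁺ (touches? u) (_ , near , z∈)

  thick-connected : ∀ u → Connected H (thick u)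
  thick-connected u = centered⇒connected {H} (μ⊆thick here (center∈ u)) λ w∈ →
    let v , near , w∈v = ∈⟦⟧⁻ (touches? u) w∈ in reach-along μ⊆thick near (center∈ u) w∈v

  open Regions H thick thick-connected

  control : ℕ → ℕ
  control D = D * (1 + (δ + δ)) + 1

  -- The ends of a step inside `thick w` lie in the regions of some `a` and `b`, both within `δ` of
  -- `w`. So a step costs `δ + δ` from `a` to `b`, plus 1 from `u` to `a`, whose regions share `x`.
  -- The last 1 in `control` joins two vertices whose regions share the final point.
  Γ⇒G : ∀ k {u v x y} → Within (Γ ⊤) k x y → x ∈ μ u → y ∈ μ v → Within G (control k) u v
  Γ⇒G k here x∈u x∈v = within-weaken (m≤n+m 1 (k * (1 + (δ + δ)))) (shared x∈u x∈v)
  Γ⇒G (suc k) {u} {v} {x} {y} (there {y = z} (x≢z , w , p) near) x∈ y∈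
    with a , w↝a , x∈a ← ∈⟦⟧⁻ (touches? w) (proj₁ (x∈p∩q⁻ (thick w) ⊤ (reach-source {H} x≢z p)))
       | b , w↝b , z∈b ← ∈⟦⟧⁻ (touches? w) (proj₁ (x∈p∩q⁻ (thick w) ⊤
           (reach-source {H} (x≢z ∘ sym) (reach-sym {G = H ⟨ thick w ∩ ⊤ ⟩} p))))
    = subst (λ m → Within G m u v) (sym (+-assoc (1 + (δ + δ)) (k * (1 + (δ + δ))) 1))
        (within-trans (within-trans (shared x∈ x∈a) (within-trans (within-sym w↝a) w↝b)) (Γ⇒G k near z∈b y∈))

  vertex-color : ∀ s → V G → Fin (2 ^ s)
  vertex-color s u = color s ⊤ (center u)

  -- By `same-roots` all centers along the chain have the roots of the first one, and by `covered`
  -- each is close to one of them; `link-within` then bounds the chain.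
  mono-bounded : ∀ s → ¬ MinorModel (K (suc (suc s))) H → ∀ {x y} → Reach (Mono {G} (vertex-color s) δ) x y →
    Within G (control (span (radius (suc s) 0) (suc s))) x y
  mono-bounded s no-minor {x} {y} p =
    Γ⇒G _ (link-within (radius (suc s) 0) (roots (suc s) ⊤ (center x)) (links p refl)) (center∈ x) (center∈ y)
    where
    qs = roots (suc s) ⊤ (center x)
    links : ∀ {u v} → Reach (Mono {G} (vertex-color s) δ) u v → roots (suc s) ⊤ (center u) ≡ qs →
      Star (Link {Γ ⊤} (radius (suc s) 0) qs) (center u) (center v)
    links ε _ = ε
    links (_◅_ {u} {w} (_ , near , eq) p) qs≡ =
      ( region-within ⊆⊤ u∈ w∈
      , subst (Any _) qs≡ (covered (suc s) no-minor (center u))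
      , subst (Any _) qs≡′ (covered (suc s) no-minor (center w)) )
      ◅ links p qs≡′
      where
      u∈ : center u ∈ thick u
      u∈ = μ⊆thick here (center∈ u)
      w∈ : center w ∈ thick u
      w∈ = μ⊆thick near (center∈ w)
      qs≡′ : roots (suc s) ⊤ (center w) ≡ qs
      qs≡′ = trans (sym (same-roots s ⊆⊤ u∈ w∈ eq)) qs≡

theorem1p3 : ∀ {ℓ} (t : ℕ) → 2 ≤ t → (𝓗 : GraphClass ℓ) → ExcludesMinor (K t) 𝓗 →
    AsdimAtMost (RegionIntersectionGraphs 𝓗) (2 ^ (t ∸ 2) ∸ 1)
theorem1p3 (suc (suc s)) (s≤s (s≤s _)) 𝓗 excludes = 2 ^ s ∸ 1 , ≤-refl , f , λ G (H , H∈𝓗 , M) → record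
  { positive  = λ δ → m≤n+m 1 (D * (1 + (δ + δ)))
  ; partition = λ δ → subst (λ k → Σ (Family G) λ 𝓤 →
        IsPartition G 𝓤 × MultiDisjoint G k δ 𝓤 × (∀ {X} → 𝓤 X → DiameterAtMost G (f δ) X))
      -- Dimension `d` allows `suc d` families; as `2 ^ s` is positive, these match the colors
      -- exactly.
      (sym (m+[n∸m]≡n (m^n>0 2 s)))
      (components-partition (Thickened.vertex-color M δ s) δ
        (Thickened.mono-bounded M δ s (excludes H H∈𝓗)))
  }
  where
  D : ℕ
  D = span (radius (suc s) 0) (suc s)
  f : ℕ → ℕ
  f δ = D * (1 + (δ + δ)) + 1
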